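{- Let $r$ be a positive integer and let $w$ be a finite word over $\{0,1\}$. If $\widetilde w$ is the word obtained by reversing the order of the bits of $w$, then $R_{1,1}(w,r)=R_{1,1}(\widetilde w,r)$ in $\mathbb{Z}[X,Y]$.
   Context: Given a finite word $w$ over $\{0,1\}$, extend it to a doubly infinite bit sequence $s:\mathbb{Z}\to\{0,1\}$ by adding infinitely many bits $1$ on its left and infinitely many bits $1$ on its right. A placement of $n$ $r$-ribbons (below the lattice path described by $s$: a unit step right for each bit $0$ and up for each bit $1$, read from left to right) is a sequence of positions $i_1<i_2<\cdots<i_n$ in $\mathbb{Z}$ such that one can successively, for $t=1,2,\dots,n$, perform the following change: the current bit sequence $s^{(t-1)}$ (with $s^{(0)}=s$) satisfies $s^{(t-1)}_{i_t-r}=1$ and $s^{(t-1)}_{i_t}=0$, and $s^{(t)}$ is obtained from it by setting the bit at $i_t-r$ to $0$ and the bit at $i_t$ to $1$. The height of the $t$-th ribbon is $\sum_{j=1}^{r-1}s^{(t-1)}_{i_t-j}$, and the total height of the placement is the sum of the heights of its $n$ ribbons. Then $$R_{1,1}(w,r)=\sum X^nY^{h},$$ the sum being over all placements of $r$-ribbons (all $n\ge0$, including the empty placement), where $n$ is the number of ribbons and $h$ the total height of the placement. (This is a polynomial.) -}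

module Defs where

open import Data.Bool using (if_then_else_)
open import Data.Digit using (Bit; 0b; 1b)
open import Data.Empty using (⊥-elim)
open import Data.Fin using (toℕ)
import Data.Fin.Properties as Fin
open import Data.Integer using (ℤ; +_; -[1+_]; 0ℤ; 1ℤ; _+_; _-_; _<_; +<+)
import Data.Integer.Properties as ℤ
open import Data.List using (List; []; _∷_; _++_; length; map; filter; upTo)
open import Data.List.Membership.Propositional using (_∈_)
open import Data.List.Membership.Propositional.Properties
  using (∈-++⁺ˡ; ∈-++⁺ʳ; ∈-map⁺; ∈-map⁻; ∈-upTo⁺; ∈-filter⁺; ∈-filter⁻)
open import Data.List.Properties using (∷-injectiveʳ)
open import Data.List.Relation.Unary.All as All using (All; []; _∷_)
import Data.List.Relation.Unary.All.Properties as All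
open import Data.List.Relation.Unary.AllPairs using (AllPairs; []; _∷_)
import Data.List.Relation.Unary.AllPairs.Properties as AllPairs
open import Data.List.Relation.Unary.Any using (here; there)
open import Data.List.Relation.Unary.Linked using (Linked; linked?)
open import Data.List.Relation.Unary.Linked.Properties using (Linked⇒AllPairs)
open import Data.List.Relation.Unary.Unique.Propositional using (Unique)
import Data.List.Relation.Unary.Unique.Propositional.Properties as Unique
open import Data.Nat as ℕ using (ℕ; zero; suc; z≤n; s≤s)
open import Data.Nat.ListAction using (sum)
import Data.Nat.Properties as ℕ
open import Data.Product using (_×_; _,_; proj₂)
open import Function using (_∘_)
open import Function.Bundles using (_⇔_; mk⇔)
open import Relation.Binary.PropositionalEquality
  using (_≡_; refl; sym; trans)
open import Relation.Nullary using (Dec; yes; no; does)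
open import Relation.Nullary.Decidable using (_×-dec_)

infix 5 _·X^_Y^_

record Term : Set where
  constructor _·X^_Y^_
  field
    coefficient : ℤ
    degX degY   : ℕ

-- A polynomial is written as a formal sum of terms, in which exponents may
-- repeat; two such sums denote the same element of ℤ[X,Y] when _≈_ holds.
ℤ[X,Y] : Set
ℤ[X,Y] = List Term

coeff : ℤ[X,Y] → ℕ → ℕ → ℤ
coeff []                  a b = 0ℤ
coeff ((c ·X^ m Y^ n) ∷ p) a b =
  (if does ((m ℕ.≟ a) ×-dec (n ℕ.≟ b)) then c else 0ℤ) + coeff p a b

infix 4 _≈_

_≈_ : ℤ[X,Y] → ℤ[X,Y] → Set
p ≈ q = ∀ a b → coeff p a b ≡ coeff q a b

Word : Set
Word = List Bit

BitSeq : Set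
BitSeq = ℤ → Bit

-- The letters of w occupy the positions 0, …, length w - 1; shifting the
-- origin shifts placements without changing their length or total height.
extend : Word → BitSeq
extend []      _           = 1b
extend (b ∷ w) -[1+ _ ]    = 1b
extend (b ∷ w) (+ zero)    = b
extend (b ∷ w) (+ (suc k)) = extend w (+ k)

_[_≔_] : BitSeq → ℤ → Bit → BitSeq
(s [ i ≔ b ]) j = if does (j ℤ.≟ i) then b else s j

addRibbon : ℕ → BitSeq → ℤ → BitSeq
addRibbon r s i = (s [ i - + r ≔ 0b ]) [ i ≔ 1b ]

-- The range j = 1, …, r - 1 is traversed as j = suc k with k < r ∸ 1.
height : ℕ → BitSeq → ℤ → ℕ
height r s i = sum (map (λ k → toℕ (s (i - + suc k))) (upTo (r ℕ.∸ 1)))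

-- The ribbons are added in list order, each to the sequence left by the
-- previous ones.
data CanAddAll (r : ℕ) (s : BitSeq) : List ℤ → Set where
  []  : CanAddAll r s []
  add : ∀ {i is} → s (i - + r) ≡ 1b → s i ≡ 0b →
        CanAddAll r (addRibbon r s i) is → CanAddAll r s (i ∷ is)

IsPlacement : ℕ → BitSeq → List ℤ → Set
IsPlacement r s is = Linked _<_ is × CanAddAll r s is

totalHeight : ℕ → BitSeq → List ℤ → ℕ
totalHeight r s []       = 0
totalHeight r s (i ∷ is) = height r s i ℕ.+ totalHeight r (addRibbon r s i) is

record Enumeration {A : Set} (P : A → Set) : Set where
  field
    elements : List A
    unique   : Unique elements
    exact    : ∀ {x} → x ∈ elements ⇔ P x

open Enumeration public using (elements)

canAddAll? : ∀ r s is → Dec (CanAddAll r s is)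
canAddAll? r s [] = yes []
canAddAll? r s (i ∷ is)
  with s (i - + r) Fin.≟ 1b | s i Fin.≟ 0b | canAddAll? r (addRibbon r s i) is
... | yes p | yes q | yes c = yes (add p q c)
... | no ¬p | _     | _     = no λ { (add p _ _) → ¬p p }
... | _     | no ¬q | _     = no λ { (add _ q _) → ¬q q }
... | _     | _     | no ¬c = no λ { (add _ _ c) → ¬c c }

isPlacement? : ∀ r s is → Dec (IsPlacement r s is)
isPlacement? r s is = linked? ℤ._<?_ is ×-dec canAddAll? r s is

subsequences : List ℤ → List (List ℤ)
subsequences []       = [] ∷ []
subsequences (x ∷ xs) = subsequences xs ++ map (x ∷_) (subsequences xs)

subsequences-All : ∀ {P : ℤ → Set} {xs} → All P xs → All (All P) (subsequences xs)
subsequences-All []         = [] ∷ []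
subsequences-All (px ∷ pxs) = All.++⁺ ih (All.map⁺ (All.map (px ∷_) ih))
  where ih = subsequences-All pxs

subsequences-unique : ∀ {xs} → AllPairs _<_ xs → Unique (subsequences xs)
subsequences-unique [] = [] ∷ []
subsequences-unique {x ∷ xs} (x< ∷ xs<) = Unique.++⁺ ih (Unique.map⁺ ∷-injectiveʳ ih) disjoint
  where
  ih = subsequences-unique xs<
  disjoint : ∀ {ys} → ys ∈ subsequences xs × ys ∈ map (x ∷_) (subsequences xs) → _
  disjoint (p , q) with ∈-map⁻ (x ∷_) q
  ... | _ , _ , refl with All.lookup (subsequences-All x<) p
  ...   | x<x ∷ _ = ℤ.<-irrefl refl x<x

∈-subsequences : ∀ {xs ys} → AllPairs _<_ xs → AllPairs _<_ ys →
                 All (_∈ xs) ys → ys ∈ subsequences xs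
∈-subsequences {[]} _ [] [] = here refl
∈-subsequences {x ∷ xs} (_ ∷ xs<) [] [] = ∈-++⁺ˡ (∈-subsequences xs< [] [])
∈-subsequences {x ∷ xs} (x< ∷ xs<) (y< ∷ ys<) (y∈ ∷ ys∈) = go y∈
  where
  drop-head : ∀ {z} → x < z → z ∈ x ∷ xs → z ∈ xs
  drop-head x<z (here refl) = ⊥-elim (ℤ.<-irrefl refl x<z)
  drop-head x<z (there z∈)  = z∈
  go : _ ∈ x ∷ xs → _
  go (here refl) = ∈-++⁺ʳ (subsequences xs) (∈-map⁺ (x ∷_)
    (∈-subsequences xs< ys< (All.zipWith (λ (lt , z∈) → drop-head lt z∈) (y< , ys∈))))
  go (there y∈) = ∈-++⁺ˡ (∈-subsequences xs< (y< ∷ ys<)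
    (y∈ ∷ All.zipWith (λ (lt , z∈) → drop-head (ℤ.<-trans (All.lookup x< y∈) lt) z∈) (y< , ys∈)))

letterPositions : Word → List ℤ
letterPositions w = map +_ (upTo (length w))

letterPositions-< : ∀ w → AllPairs _<_ (letterPositions w)
letterPositions-< w =
  AllPairs.map⁺ (AllPairs.applyUpTo⁺₁ _ (length w) (λ i<j _ → +<+ i<j))

extend-0⇒∈ : ∀ w i → extend w i ≡ 0b → i ∈ letterPositions w
extend-0⇒∈ (b ∷ w) -[1+ _ ] ()
extend-0⇒∈ w (+ k) eq = ∈-map⁺ +_ (∈-upTo⁺ (bound w k eq))
  where
  bound : ∀ w k → extend w (+ k) ≡ 0b → k ℕ.< length w
  bound (b ∷ w) zero    _  = s≤s z≤n
  bound (b ∷ w) (suc k) eq = s≤s (bound w k eq)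

addRibbon-beyond : ∀ r s {i j} → i < j → addRibbon r s i j ≡ s j
addRibbon-beyond r s {i} {j} i<j with j ℤ.≟ i
... | yes refl = ⊥-elim (ℤ.<-irrefl refl i<j)
... | no _ with j ℤ.≟ i - + r
...   | yes refl = ⊥-elim (ℤ.<-irrefl refl (ℤ.<-≤-trans i<j (ℤ.i-j≤i i (+ r))))
...   | no _ = refl

placement-0 : ∀ {r s is} → AllPairs _<_ is → CanAddAll r s is → All (λ i → s i ≡ 0b) is
placement-0 [] [] = []
placement-0 {r} {s} (i< ∷ is<) (add _ q c) =
  q ∷ All.zipWith (λ (lt , eq) → trans (sym (addRibbon-beyond r s lt)) eq)
                  (i< , placement-0 is< c)

-- Ribbons are added at increasing positions, so each one sits at a 0 of the
-- original sequence; hence the finitely many candidates below suffice.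
placements : ∀ w r → Enumeration (IsPlacement r (extend w))
placements w r = record
  { elements = filter P? candidates
  ; unique   = Unique.filter⁺ P? (subsequences-unique (letterPositions-< w))
  ; exact    = mk⇔ (proj₂ ∘ ∈-filter⁻ P? {xs = candidates})
                   (λ p → ∈-filter⁺ P? (candidate p) p)
  }
  where
  P?         = isPlacement? r (extend w)
  candidates = subsequences (letterPositions w)
  candidate : ∀ {is} → IsPlacement r (extend w) is → is ∈ candidates
  candidate (l , c) = ∈-subsequences (letterPositions-< w) is<
    (All.map (λ {i} → extend-0⇒∈ w i) (placement-0 is< c))
    where is< = Linked⇒AllPairs ℤ.<-trans l

R₁₁ : Word → ℕ → ℤ[X,Y]
R₁₁ w r = map (λ is → 1ℤ ·X^ length is Y^ totalHeight r (extend w) is)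
              (elements (placements w r))

{-# OPTIONS --safe #-}
module Submission where

-- View the bits 0 as particles. A ribbon at i moves the particle at i to i - r, and as
-- ribbons come in increasing order each particle moves at most once. So a placement is a
-- colouring of the particles by stay/move in which no stay lies r to the left of a move,
-- and each move has height r - 1 minus the number of stays in the window to its left.
-- Reversing the word and exchanging the two colours preserves the set of pairs
-- (stay j, move i) with i - j < r, or = r. Hence it suffices that
-- G(w) = Σ x^#stay y^#move q^#{pairs with i - j < r} over the admissible colourings is
-- symmetric in x and y. Put a particle in front of w: if Z is the set of particles of w
-- within distance < r of it, and v₀ the one at distance r, if any, then
--   G(0w) = (x + y) G(w) + x y (Σ_{v ∈ Z} (q - 1) q^(z v) G(w - v) - q^(z v₀) G(w - v₀)),
-- where z v is the number of particles of w before v: if v moves, each of these contributes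
-- exactly one q, through its pair with v if it stays and with the new particle if it moves.
-- So symmetry follows by induction. If the forbidden pairs carry a fourth variable t instead
-- of being excluded, the last term gets the factor t - 1, like the factors q - 1.

open import Defs
open import Algebra.Properties.AbelianGroup using (∙-cancelˡ)
open import Data.Bool using (true; false; if_then_else_)
open import Data.Digit using (Bit; 0b; 1b)
open import Data.Empty using (⊥-elim)
open import Data.Fin using (zero; suc; toℕ)
open import Data.Integer as ℤ using (ℤ; +_; 0ℤ; 1ℤ; +<+)
import Data.Integer.Properties as ℤ
import Data.Integer.Solver as ℤSolver
open import Data.List using (List; []; _∷_; _++_; _∷ʳ_; length; map; reverse; _ʳ++_; filter; applyUpTo)
open import Data.List.Properties using (++-assoc; length-++; map-applyUpTo; reverse-involutive)
open import Data.List.Relation.Unary.All as All using (All; []; _∷_)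
import Data.List.Relation.Unary.All.Properties as All
open import Data.List.Relation.Unary.AllPairs using (AllPairs; []; _∷_)
open import Data.List.Relation.Unary.Linked.Properties using (AllPairs⇒Linked)
open import Data.Nat using (ℕ; zero; suc; _+_; _*_; _∸_; _≟_; _≤_; _<_; z≤n; s≤s; NonZero)
open import Data.Nat.Properties
open import Data.Nat.ListAction using (sum)
import Data.Nat.Solver as ℕSolver
open import Data.Product using (_×_; _,_; proj₂)
open import Function using (_∘_)
open import Function.Bundles using (mk⇔)
open import Relation.Binary.PropositionalEquality
open import Relation.Nullary using (¬_; does)
open import Relation.Nullary.Decidable using (_×-dec_; dec-true; dec-false; does-⇔)
open import Relation.Unary using (Decidable)

-- Sums over the colourings of the zeros of a word.

data Colour : Set where
  empty stay move : Colour

∑ : Word → (List Colour → ℤ) → ℤ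
∑ []          f = f []
∑ (zero  ∷ w) f = ∑ w (f ∘ (stay ∷_)) ℤ.+ ∑ w (f ∘ (move ∷_))
∑ (suc _ ∷ w) f = ∑ w (f ∘ (empty ∷_))

∑-cong : ∀ w {f g} → (∀ κ → f κ ≡ g κ) → ∑ w f ≡ ∑ w g
∑-cong []          f≗g = f≗g []
∑-cong (zero  ∷ w) f≗g = cong₂ ℤ._+_ (∑-cong w (f≗g ∘ _)) (∑-cong w (f≗g ∘ _))
∑-cong (suc _ ∷ w) f≗g = ∑-cong w (f≗g ∘ _)

∑-length-cong : ∀ w {f g} → (∀ κ → length κ ≡ length w → f κ ≡ g κ) → ∑ w f ≡ ∑ w g
∑-length-cong []          f≗g = f≗g [] refl
∑-length-cong (zero  ∷ w) f≗g = cong₂ ℤ._+_ (∑-length-cong w λ κ eq → f≗g _ (cong suc eq))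
                                            (∑-length-cong w λ κ eq → f≗g _ (cong suc eq))
∑-length-cong (suc _ ∷ w) f≗g = ∑-length-cong w λ κ eq → f≗g _ (cong suc eq)

ℤ-interchange : ∀ a b c d → (a ℤ.+ b) ℤ.+ (c ℤ.+ d) ≡ (a ℤ.+ c) ℤ.+ (b ℤ.+ d)
ℤ-interchange = solve 4 (λ a b c d → (a :+ b) :+ (c :+ d) := (a :+ c) :+ (b :+ d)) refl
  where open ℤSolver.+-*-Solver

∑-+ : ∀ w f g → ∑ w (λ κ → f κ ℤ.+ g κ) ≡ ∑ w f ℤ.+ ∑ w g
∑-+ []          f g = refl
∑-+ (zero  ∷ w) f g =
  trans (cong₂ ℤ._+_ (∑-+ w _ _) (∑-+ w _ _)) (ℤ-interchange (∑ w _) (∑ w _) (∑ w _) (∑ w _))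
∑-+ (suc _ ∷ w) f g = ∑-+ w _ _

∑-0 : ∀ w → ∑ w (λ _ → 0ℤ) ≡ 0ℤ
∑-0 []          = refl
∑-0 (zero  ∷ w) = cong₂ ℤ._+_ (∑-0 w) (∑-0 w)
∑-0 (suc _ ∷ w) = ∑-0 w

∑-++ : ∀ u v f → ∑ (u ++ v) f ≡ ∑ u (λ μ → ∑ v (λ κ → f (μ ++ κ)))
∑-++ []          v f = refl
∑-++ (zero  ∷ u) v f = cong₂ ℤ._+_ (∑-++ u v _) (∑-++ u v _)
∑-++ (suc _ ∷ u) v f = ∑-++ u v _

∑-∷ʳ : ∀ u w b (F : List Colour → List Colour → ℤ) →
  ∑ (u ∷ʳ b) (λ μ → ∑ w (F μ)) ≡ ∑ u (λ μ → ∑ (b ∷ []) (λ c → ∑ w (F (μ ++ c))))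
∑-∷ʳ u w b F = ∑-++ u (b ∷ []) (λ μ → ∑ w (F μ))

∑-ʳ++ : ∀ u v f → ∑ (u ʳ++ v) f ≡ ∑ v (λ κ → ∑ u (λ μ → f (μ ʳ++ κ)))
∑-ʳ++ []          v f = refl
∑-ʳ++ (zero  ∷ u) v f = trans (∑-ʳ++ u (zero ∷ v) f) (sym (∑-+ v _ _))
∑-ʳ++ (suc zero ∷ u) v f = ∑-ʳ++ u (suc zero ∷ v) f

∑-reverse : ∀ w f → ∑ (reverse w) f ≡ ∑ w (f ∘ reverse)
∑-reverse w f = ∑-ʳ++ w [] f

swap : Colour → Colour
swap empty = empty
swap stay  = move
swap move  = stay

∑-swap : ∀ w f → ∑ w (f ∘ map swap) ≡ ∑ w f
∑-swap []          f = refl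
∑-swap (zero  ∷ w) f =
  trans (cong₂ ℤ._+_ (∑-swap w _) (∑-swap w _)) (ℤ.+-comm (∑ w (f ∘ (move ∷_))) _)
∑-swap (suc _ ∷ w) f = ∑-swap w _

-- Statistics of a colouring: particles and pairs.

stays moves occupied : List Colour → ℕ
stays []         = 0
stays (stay ∷ κ) = suc (stays κ)
stays (_    ∷ κ) = stays κ
moves []         = 0
moves (move ∷ κ) = suc (moves κ)
moves (_    ∷ κ) = moves κ
occupied []          = 0
occupied (empty ∷ κ) = occupied κ
occupied (_     ∷ κ) = suc (occupied κ)

zeros : Word → ℕ
zeros []          = 0
zeros (zero  ∷ w) = suc (zeros w)
zeros (suc _ ∷ w) = zeros w

-- Every colouring in the sum occupies exactly the zeros of `w`, so an exponent `occupied κ` is a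
-- constant and can leave the sum.
∑-occupied : ∀ w (F : ℕ → List Colour → ℤ) →
             ∑ w (λ κ → F (occupied κ) κ) ≡ ∑ w (F (zeros w))
∑-occupied []          F = refl
∑-occupied (zero  ∷ w) F = cong₂ ℤ._+_ (∑-occupied w (λ n κ → F (suc n) (stay ∷ κ)))
                                       (∑-occupied w (λ n κ → F (suc n) (move ∷ κ)))
∑-occupied (suc _ ∷ w) F = ∑-occupied w (λ n κ → F n (empty ∷ κ))

whenMove whenStay : Colour → ℕ → ℕ
whenMove move n = n
whenMove _    n = 0
whenStay stay n = n
whenStay _    n = 0

movesBy staysBy inv : (ℕ → ℕ) → List Colour → ℕ
movesBy g []      = 0
movesBy g (c ∷ κ) = whenMove c (g 0) + movesBy (g ∘ suc) κ
staysBy g []      = 0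
staysBy g (c ∷ κ) = whenStay c (g 0) + staysBy (g ∘ suc) κ

-- The sum of g (i - j - 1) over all j < i such that j stays and i moves. With g = below p
-- these are the pairs lowering the height, with g = at p the forbidden ones (r = p + 1).
inv g []      = 0
inv g (c ∷ κ) = whenStay c (movesBy g κ) + inv g κ

-- The indicators of `d < n` and `d = n`, by recursion, so that `below (suc n) ∘ suc` computes to
-- `below n` and likewise for `at`: stepping over a letter shrinks the window without any proof.
below at : ℕ → ℕ → ℕ
below zero    _       = 0
below (suc n) zero    = 1
below (suc n) (suc d) = below n d
at zero    zero    = 1
at zero    (suc _) = 0
at (suc n) zero    = 0
at (suc n) (suc d) = at n d

movesBy-0 : ∀ κ → movesBy (λ _ → 0) κ ≡ 0
movesBy-0 []          = refl
movesBy-0 (empty ∷ κ) = movesBy-0 κ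
movesBy-0 (stay  ∷ κ) = movesBy-0 κ
movesBy-0 (move  ∷ κ) = movesBy-0 κ

staysBy-0 : ∀ κ → staysBy (λ _ → 0) κ ≡ 0
staysBy-0 []          = refl
staysBy-0 (empty ∷ κ) = staysBy-0 κ
staysBy-0 (stay  ∷ κ) = staysBy-0 κ
staysBy-0 (move  ∷ κ) = staysBy-0 κ

stays-move : ∀ μ ν → stays (μ ++ move ∷ ν) ≡ stays (μ ++ empty ∷ ν)
stays-move []          ν = refl
stays-move (empty ∷ μ) ν = stays-move μ ν
stays-move (stay  ∷ μ) ν = cong suc (stays-move μ ν)
stays-move (move  ∷ μ) ν = stays-move μ ν

moves-move : ∀ μ ν → moves (μ ++ move ∷ ν) ≡ suc (moves (μ ++ empty ∷ ν))
moves-move []          ν = refl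
moves-move (empty ∷ μ) ν = moves-move μ ν
moves-move (stay  ∷ μ) ν = moves-move μ ν
moves-move (move  ∷ μ) ν = cong suc (moves-move μ ν)

movesBy-below-move : ∀ {p} μ ν → length μ < p →
  movesBy (below p) (μ ++ move ∷ ν) ≡ suc (movesBy (below p) (μ ++ empty ∷ ν))
movesBy-below-move {suc p} []      ν _ = refl
movesBy-below-move {suc p} (c ∷ μ) ν (s≤s μ<p) =
  trans (cong (λ n → whenMove c 1 + n) (movesBy-below-move μ ν μ<p)) (+-suc (whenMove c 1) _)

movesBy-at-move : ∀ {p} μ ν → length μ < p →
  movesBy (at p) (μ ++ move ∷ ν) ≡ movesBy (at p) (μ ++ empty ∷ ν)
movesBy-at-move {suc p} []      ν _ = refl
movesBy-at-move {suc p} (c ∷ μ) ν (s≤s μ<p) =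
  cong (λ n → whenMove c 0 + n) (movesBy-at-move μ ν μ<p)

-- `μ` is too short to contain the position `p + 1` to the left of the new move, so no forbidden
-- pair arises.
inv-at-move : ∀ {p} μ ν → length μ ≤ p →
  inv (at p) (μ ++ move ∷ ν) ≡ inv (at p) (μ ++ empty ∷ ν)
inv-at-move []          ν _   = refl
inv-at-move (empty ∷ μ) ν μ<p = inv-at-move μ ν (<⇒≤ μ<p)
inv-at-move (stay  ∷ μ) ν μ<p = cong₂ _+_ (movesBy-at-move μ ν μ<p) (inv-at-move μ ν (<⇒≤ μ<p))
inv-at-move (move  ∷ μ) ν μ<p = inv-at-move μ ν (<⇒≤ μ<p)

-- All of `μ` lies in the window of the new move, which therefore forms one pair with each stay of
-- `μ`. Stays and moves of `μ` together are its occupied letters.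
inv-below-move : ∀ {p} μ ν → length μ ≤ p →
  moves μ + inv (below p) (μ ++ move ∷ ν) ≡ occupied μ + inv (below p) (μ ++ empty ∷ ν)
inv-below-move []          ν _   = refl
inv-below-move (empty ∷ μ) ν μ<p = inv-below-move μ ν (<⇒≤ μ<p)
inv-below-move {p} (stay ∷ μ) ν μ<p = begin
  moves μ + (movesBy (below p) (μ ++ move ∷ ν) + i)
    ≡⟨ cong (λ n → moves μ + (n + i)) (movesBy-below-move μ ν μ<p) ⟩
  moves μ + suc (m + i)
    ≡⟨ solve 3 (λ a m i → a :+ (con 1 :+ (m :+ i)) := con 1 :+ (m :+ (a :+ i))) refl (moves μ) m i ⟩
  suc (m + (moves μ + i))
    ≡⟨ cong (λ n → suc (m + n)) (inv-below-move μ ν (<⇒≤ μ<p)) ⟩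
  suc (m + (occupied μ + j))
    ≡⟨ solve 3 (λ a m j → con 1 :+ (m :+ (a :+ j)) := con 1 :+ (a :+ (m :+ j))) refl (occupied μ) m j ⟩
  suc (occupied μ + (m + j)) ∎
  where
  open ≡-Reasoning
  open ℕSolver.+-*-Solver
  i = inv (below p) (μ ++ move ∷ ν)
  j = inv (below p) (μ ++ empty ∷ ν)
  m = movesBy (below p) (μ ++ empty ∷ ν)
inv-below-move (move ∷ μ) ν μ<p = cong suc (inv-below-move μ ν (<⇒≤ μ<p))

moves-∷ʳ : ∀ μ c → moves (μ ∷ʳ c) ≡ moves μ + whenMove c 1
moves-∷ʳ []          empty = refl
moves-∷ʳ []          stay  = refl
moves-∷ʳ []          move  = refl
moves-∷ʳ (empty ∷ μ) c = moves-∷ʳ μ c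
moves-∷ʳ (stay  ∷ μ) c = moves-∷ʳ μ c
moves-∷ʳ (move  ∷ μ) c = cong suc (moves-∷ʳ μ c)

length-∷ʳ-+ : ∀ (u : Word) b n → length (u ∷ʳ b) + n ≡ length u + suc n
length-∷ʳ-+ u b n = trans (cong (_+ n) (length-++ u)) (+-assoc (length u) 1 n)

-- The recursion for the generating function and its symmetry.

-- A polynomial in four variables is represented by its pairing with a test
-- function φ on exponents, so that multiplication by a monomial is a shift of φ.
Test : Set
Test = ℕ → ℕ → ℕ → ℕ → ℤ

shiftStay shiftMove : Test → Test
shiftStay φ s m = φ (suc s) m
shiftMove φ s m = φ s (suc m)

exchange : Test → Test
exchange φ s m = φ m s

module _ (p : ℕ) where

  -- `i` and `b` are exponents of `q` and `t` contributed from outside `κ`, by pairs with a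
  -- preceding staying zero.
  value : Test → ℕ → ℕ → List Colour → ℤ
  value φ i b κ = φ (stays κ) (moves κ) (i + inv (below p) κ) (b + inv (at p) κ)

  value-cong : ∀ φ {i i′ b b′} κ → i ≡ i′ → b ≡ b′ → value φ i b κ ≡ value φ i′ b′ κ
  value-cong φ κ refl refl = refl

  value-move : ∀ φ k b μ ν → length μ ≤ p →
    value φ (k + moves μ) b (μ ++ move ∷ ν) ≡ value (shiftMove φ) (k + occupied μ) b (μ ++ empty ∷ ν)
  value-move φ k b μ ν μ≤p
    rewrite stays-move μ ν | moves-move μ ν | inv-at-move {p} μ ν μ≤p
          | +-assoc k (moves μ) (inv (below p) (μ ++ move ∷ ν)) | inv-below-move {p} μ ν μ≤p
          | +-assoc k (occupied μ) (inv (below p) (μ ++ empty ∷ ν)) = refl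

  -- The term `q^(z v) G(w - v)` of the recursion: the moving particle `v` after `u` is erased, that
  -- is, replaced by the letter 1. `k` or `b` is 1 when its pair with the preceding staying zero is
  -- counted as near or as forbidden.
  ∑-move : ∀ φ k b u w → length u ≤ p →
    ∑ u (λ μ → ∑ w (λ κ → value φ (k + moves μ) b (μ ++ move ∷ κ)))
      ≡ ∑ (u ++ 1b ∷ w) (value (shiftMove φ) (k + zeros u) b)
  ∑-move φ k b u w u≤p = begin
    ∑ u (λ μ → ∑ w (λ κ → value φ (k + moves μ) b (μ ++ move ∷ κ)))
      ≡⟨ ∑-length-cong u (λ μ eq → ∑-cong w (λ κ →
           value-move φ k b μ κ (≤-trans (≤-reflexive eq) u≤p))) ⟩
    ∑ u (λ μ → ∑ w (λ κ → value (shiftMove φ) (k + occupied μ) b (μ ++ empty ∷ κ)))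
      ≡⟨ ∑-occupied u (λ n μ → ∑ w (λ κ → value (shiftMove φ) (k + n) b (μ ++ empty ∷ κ))) ⟩
    ∑ u (λ μ → ∑ w (λ κ → value (shiftMove φ) (k + zeros u) b (μ ++ empty ∷ κ)))
      ≡⟨ ∑-++ u (1b ∷ w) _ ⟨
    ∑ (u ++ 1b ∷ w) (value (shiftMove φ) (k + zeros u) b) ∎
    where open ≡-Reasoning

  -- The colourings of u ++ w counted as if preceded by a staying zero whose window
  -- (all of u, then n letters, then the forbidden one) is taken into account
  -- entirely, or only as far as u goes.
  withWindow : ℕ → Word → Word → Test → ℤ
  withWindow n u w φ = ∑ u (λ μ → ∑ w (λ κ →
    value φ (moves μ + movesBy (below n) κ) (movesBy (at n) κ) (μ ++ κ)))

  withPrefix : Word → Word → Test → ℤ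
  withPrefix u w φ = ∑ u (λ μ → ∑ w (λ κ → value φ (moves μ) 0 (μ ++ κ)))

  withPrefix-0 : ∀ u w φ → withPrefix u (0b ∷ w) φ ≡
    ∑ u (λ μ → ∑ w (λ κ → value φ (moves μ) 0 (μ ++ stay ∷ κ))) ℤ.+
    ∑ u (λ μ → ∑ w (λ κ → value φ (moves μ) 0 (μ ++ move ∷ κ)))
  withPrefix-0 u w φ = ∑-+ u _ _

  -- Compared with `withPrefix-0`, the move at the new letter is now counted once more; this is the
  -- source of the factor `q - 1`.
  withPrefix-∷ʳ0 : ∀ u w φ → withPrefix (u ∷ʳ 0b) w φ ≡
    ∑ u (λ μ → ∑ w (λ κ → value φ (moves μ) 0 (μ ++ stay ∷ κ))) ℤ.+
    ∑ u (λ μ → ∑ w (λ κ → value φ (1 + moves μ) 0 (μ ++ move ∷ κ)))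
  withPrefix-∷ʳ0 u w φ = trans (∑-∷ʳ u w 0b _) (trans (∑-+ u _ _) (cong₂ ℤ._+_
    (∑-cong u λ μ → ∑-cong w λ κ → lemma μ κ stay (+-identityʳ _))
    (∑-cong u λ μ → ∑-cong w λ κ → lemma μ κ move (+-comm _ 1))))
    where
    lemma : ∀ μ κ c {n} → moves μ + whenMove c 1 ≡ n →
      value φ (moves (μ ∷ʳ c)) 0 ((μ ∷ʳ c) ++ κ) ≡ value φ n 0 (μ ++ c ∷ κ)
    lemma μ κ c eq = trans
      (cong (value φ _ 0) (++-assoc μ (c ∷ []) κ))
      (value-cong φ (μ ++ c ∷ κ) (trans (moves-∷ʳ μ c) eq) refl)

  withPrefix-∷ʳ1 : ∀ u w φ → withPrefix (u ∷ʳ 1b) w φ ≡ withPrefix u (1b ∷ w) φ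
  withPrefix-∷ʳ1 u w φ = trans (∑-∷ʳ u w 1b _) (∑-cong u λ μ → ∑-cong w λ κ → trans
    (cong (value φ _ 0) (++-assoc μ (empty ∷ []) κ))
    (value-cong φ (μ ++ empty ∷ κ) (trans (moves-∷ʳ μ empty) (+-identityʳ _)) refl))

  -- The first letter of a nonempty window is counted by `below` just as a letter of `u` is by
  -- `moves`, and not at all by `at`.
  withWindow-∷ʳ : ∀ n u b w φ → withWindow n (u ∷ʳ b) w φ ≡ withWindow (suc n) u (b ∷ w) φ
  withWindow-∷ʳ n u b w φ = trans (∑-∷ʳ u w b _) (∑-cong u (λ μ → step μ b))
    where
    lemma : ∀ μ κ c → value φ (moves (μ ∷ʳ c) + movesBy (below n) κ) (movesBy (at n) κ) ((μ ∷ʳ c) ++ κ)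
      ≡ value φ (moves μ + movesBy (below (suc n)) (c ∷ κ)) (movesBy (at (suc n)) (c ∷ κ)) (μ ++ c ∷ κ)
    lemma μ κ c = trans
      (cong (value φ _ _) (++-assoc μ (c ∷ []) κ))
      (value-cong φ (μ ++ c ∷ κ)
        (trans (cong (_+ _) (moves-∷ʳ μ c)) (+-assoc (moves μ) _ _)) (at-c c))
      where
      at-c : ∀ c → movesBy (at n) κ ≡ whenMove c 0 + movesBy (at n) κ
      at-c empty = refl
      at-c stay  = refl
      at-c move  = refl
    step : ∀ μ b → ∑ (b ∷ []) (λ c → ∑ w (λ κ →
        value φ (moves (μ ++ c) + movesBy (below n) κ) (movesBy (at n) κ) ((μ ++ c) ++ κ)))
      ≡ ∑ (b ∷ w) (λ κ →
        value φ (moves μ + movesBy (below (suc n)) κ) (movesBy (at (suc n)) κ) (μ ++ κ))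
    step μ zero    = cong₂ ℤ._+_ (∑-cong w λ κ → lemma μ κ stay) (∑-cong w λ κ → lemma μ κ move)
    step μ (suc _) = ∑-cong w λ κ → lemma μ κ empty

  -- withWindow - withPrefix is the bracket of the recursion, taken here for two tests φ
  -- and φ′ at once, with its negative terms moved to the other side.
  window-prefix : ∀ n u w φ φ′ → length u + n ≤ p →
    (∀ i b w′ → length w′ ≡ length u + length w →
      ∑ w′ (value (shiftMove φ) i b) ≡ ∑ w′ (value (shiftMove φ′) i b)) →
    withWindow n u w φ ℤ.+ withPrefix u w φ′ ≡ withWindow n u w φ′ ℤ.+ withPrefix u w φ
  window-prefix n u [] φ φ′ _ _ = begin
    withWindow n u [] φ ℤ.+ withPrefix u [] φ′ ≡⟨ cong₂ ℤ._+_ (eq φ) (sym (eq φ′)) ⟩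
    withPrefix u [] φ ℤ.+ withWindow n u [] φ′ ≡⟨ ℤ.+-comm (withPrefix u [] φ) _ ⟩
    withWindow n u [] φ′ ℤ.+ withPrefix u [] φ ∎
    where
    open ≡-Reasoning
    eq : ∀ φ → withWindow n u [] φ ≡ withPrefix u [] φ
    eq φ = ∑-cong u λ μ → value-cong φ (μ ++ []) (+-identityʳ _) refl
  window-prefix zero u (suc zero ∷ w) φ φ′ _ _ = begin
    withWindow zero u (1b ∷ w) φ ℤ.+ withPrefix u (1b ∷ w) φ′ ≡⟨ cong₂ ℤ._+_ (eq φ) (sym (eq φ′)) ⟩
    withPrefix u (1b ∷ w) φ ℤ.+ withWindow zero u (1b ∷ w) φ′ ≡⟨ ℤ.+-comm (withPrefix u (1b ∷ w) φ) _ ⟩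
    withWindow zero u (1b ∷ w) φ′ ℤ.+ withPrefix u (1b ∷ w) φ ∎
    where
    open ≡-Reasoning
    eq : ∀ φ → withWindow zero u (1b ∷ w) φ ≡ withPrefix u (1b ∷ w) φ
    eq φ = ∑-cong u λ μ → ∑-cong w λ κ → value-cong φ (μ ++ empty ∷ κ)
      (trans (cong (λ n → moves μ + n) (movesBy-0 κ)) (+-identityʳ _)) (movesBy-0 κ)
  -- The window is used up, so this 0 is the particle `v₀` at distance `r`. The two sums differ only
  -- where it moves, by `B 1` against `B 0`: the factor `t - 1`.
  window-prefix zero u (zero ∷ w) φ φ′ u≤p sym-φ = begin
    withWindow zero u (0b ∷ w) φ ℤ.+ withPrefix u (0b ∷ w) φ′
      ≡⟨ cong₂ ℤ._+_ (split φ) (withPrefix-0 u w φ′) ⟩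
    (A φ ℤ.+ B 1 φ) ℤ.+ (A φ′ ℤ.+ B 0 φ′)
      ≡⟨ cong₂ (λ x y → (A φ ℤ.+ x) ℤ.+ (A φ′ ℤ.+ y)) (B-sym 1) (sym (B-sym 0)) ⟩
    (A φ ℤ.+ B 1 φ′) ℤ.+ (A φ′ ℤ.+ B 0 φ)
      ≡⟨ solve 4 (λ a b c d → (a :+ b) :+ (c :+ d) := (c :+ b) :+ (a :+ d)) refl (A φ) (B 1 φ′) (A φ′) (B 0 φ) ⟩
    (A φ′ ℤ.+ B 1 φ′) ℤ.+ (A φ ℤ.+ B 0 φ)
      ≡⟨ cong₂ ℤ._+_ (split φ′) (withPrefix-0 u w φ) ⟨
    withWindow zero u (0b ∷ w) φ′ ℤ.+ withPrefix u (0b ∷ w) φ ∎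
    where
    open ≡-Reasoning
    open ℤSolver.+-*-Solver
    A : Test → ℤ
    A φ = ∑ u (λ μ → ∑ w (λ κ → value φ (moves μ) 0 (μ ++ stay ∷ κ)))
    B : ℕ → Test → ℤ
    B b φ = ∑ u (λ μ → ∑ w (λ κ → value φ (moves μ) b (μ ++ move ∷ κ)))
    split : ∀ φ → withWindow zero u (0b ∷ w) φ ≡ A φ ℤ.+ B 1 φ
    split φ = trans (∑-+ u _ _) (cong₂ ℤ._+_
      (∑-cong u λ μ → ∑-cong w λ κ → value-cong φ (μ ++ stay ∷ κ)
        (trans (cong (λ n → moves μ + n) (movesBy-0 κ)) (+-identityʳ _)) (movesBy-0 κ))
      (∑-cong u λ μ → ∑-cong w λ κ → value-cong φ (μ ++ move ∷ κ)
        (trans (cong (λ n → moves μ + n) (movesBy-0 κ)) (+-identityʳ _)) (cong suc (movesBy-0 κ))))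
    u≤p′ = ≤-trans (m≤m+n (length u) 0) u≤p
    B-sym : ∀ b → B b φ ≡ B b φ′
    B-sym b = trans (∑-move φ 0 b u w u≤p′)
      (trans (sym-φ (zeros u) b (u ++ 1b ∷ w) (length-++ u)) (sym (∑-move φ′ 0 b u w u≤p′)))
  window-prefix (suc n) u (suc zero ∷ w) φ φ′ u+n≤p sym-φ = begin
    withWindow (suc n) u (1b ∷ w) φ ℤ.+ withPrefix u (1b ∷ w) φ′
      ≡⟨ cong₂ ℤ._+_ (withWindow-∷ʳ n u 1b w φ) (withPrefix-∷ʳ1 u w φ′) ⟨
    withWindow n (u ∷ʳ 1b) w φ ℤ.+ withPrefix (u ∷ʳ 1b) w φ′
      ≡⟨ window-prefix n (u ∷ʳ 1b) w φ φ′ (≤-trans (≤-reflexive (length-∷ʳ-+ u 1b n)) u+n≤p)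
           (λ i b w′ eq → sym-φ i b w′ (trans eq (length-∷ʳ-+ u 1b (length w)))) ⟩
    withWindow n (u ∷ʳ 1b) w φ′ ℤ.+ withPrefix (u ∷ʳ 1b) w φ
      ≡⟨ cong₂ ℤ._+_ (withWindow-∷ʳ n u 1b w φ′) (withPrefix-∷ʳ1 u w φ) ⟩
    withWindow (suc n) u (1b ∷ w) φ′ ℤ.+ withPrefix u (1b ∷ w) φ ∎
    where
    open ≡-Reasoning
  window-prefix (suc n) u (zero ∷ w) φ φ′ u+n≤p sym-φ = begin
    withWindow (suc n) u (0b ∷ w) φ ℤ.+ withPrefix u (0b ∷ w) φ′
      ≡⟨ cong₂ ℤ._+_ (sym (withWindow-∷ʳ n u 0b w φ)) (withPrefix-0 u w φ′) ⟩
    C φ ℤ.+ (A φ′ ℤ.+ B 0 φ′)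
      -- Trading `B 0` for `B 1` absorbs the letter into the prefix, where induction applies. The
      -- remainder is a term with factor `q - 1`, on which both tests agree by `B-sym`.
      ≡⟨ solve 4 (λ c a b d → c :+ (a :+ b) := (c :+ (a :+ d)) :+ (b :- d)) refl (C φ) (A φ′) (B 0 φ′) (B 1 φ′) ⟩
    (C φ ℤ.+ (A φ′ ℤ.+ B 1 φ′)) ℤ.+ (B 0 φ′ ℤ.- B 1 φ′)
      ≡⟨ cong₂ (λ x y → (C φ ℤ.+ x) ℤ.+ y) (sym (withPrefix-∷ʳ0 u w φ′)) (cong₂ ℤ._-_ (sym (B-sym 0)) (sym (B-sym 1))) ⟩
    (C φ ℤ.+ withPrefix (u ∷ʳ 0b) w φ′) ℤ.+ (B 0 φ ℤ.- B 1 φ)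
      ≡⟨ cong (ℤ._+ (B 0 φ ℤ.- B 1 φ)) (window-prefix n (u ∷ʳ 0b) w φ φ′ (≤-trans (≤-reflexive (length-∷ʳ-+ u 0b n)) u+n≤p)
           (λ i b w′ eq → sym-φ i b w′ (trans eq (length-∷ʳ-+ u 0b (length w))))) ⟩
    (C φ′ ℤ.+ withPrefix (u ∷ʳ 0b) w φ) ℤ.+ (B 0 φ ℤ.- B 1 φ)
      ≡⟨ cong (λ x → (C φ′ ℤ.+ x) ℤ.+ (B 0 φ ℤ.- B 1 φ)) (withPrefix-∷ʳ0 u w φ) ⟩
    (C φ′ ℤ.+ (A φ ℤ.+ B 1 φ)) ℤ.+ (B 0 φ ℤ.- B 1 φ)
      ≡⟨ solve 4 (λ c a b d → c :+ (a :+ b) := (c :+ (a :+ d)) :+ (b :- d)) refl (C φ′) (A φ) (B 0 φ) (B 1 φ) ⟨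
    C φ′ ℤ.+ (A φ ℤ.+ B 0 φ)
      ≡⟨ cong₂ ℤ._+_ (withWindow-∷ʳ n u 0b w φ′) (sym (withPrefix-0 u w φ)) ⟩
    withWindow (suc n) u (0b ∷ w) φ′ ℤ.+ withPrefix u (0b ∷ w) φ ∎
    where
    open ≡-Reasoning
    open ℤSolver.+-*-Solver
    A C : Test → ℤ
    A φ = ∑ u (λ μ → ∑ w (λ κ → value φ (moves μ) 0 (μ ++ stay ∷ κ)))
    C φ = withWindow n (u ∷ʳ 0b) w φ
    B : ℕ → Test → ℤ
    B k φ = ∑ u (λ μ → ∑ w (λ κ → value φ (k + moves μ) 0 (μ ++ move ∷ κ)))
    u≤p : length u ≤ p
    u≤p = ≤-trans (m≤m+n (length u) (suc n)) u+n≤p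
    B-sym : ∀ k → B k φ ≡ B k φ′
    B-sym k = trans (∑-move φ k 0 u w u≤p)
      (trans (sym-φ (k + zeros u) 0 (u ++ 1b ∷ w) (length-++ u)) (sym (∑-move φ′ k 0 u w u≤p)))

  -- Induction on the length, not on the word: the recursion also uses `w` with a zero replaced by
  -- 1, which is no suffix of `0b ∷ w` but is as long as `w`.
  ∑-exchange : ∀ n w → length w ≡ n → ∀ φ → ∑ w (value φ 0 0) ≡ ∑ w (value (exchange φ) 0 0)
  ∑-exchange zero    []          _  φ = refl
  ∑-exchange (suc n) (suc _ ∷ w) eq φ = ∑-exchange n w (suc-injective eq) φ
  ∑-exchange (suc n) (zero ∷ w)  eq φ = begin
    ∑ w (λ κ → value φ 0 0 (stay ∷ κ)) ℤ.+ ∑ w (value (shiftMove φ) 0 0)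
      -- A leading move forms no pair, and exchanging `shiftMove φ` gives `shiftStay (exchange φ)`.
      -- For the empty prefix, `withPrefix` is the plain sum and `withWindow p` holds all pairs of a
      -- leading stay.
      ≡⟨ cong (λ n → withWindow p [] w (shiftStay φ) ℤ.+ n) (∑-exchange n w n≡ (shiftMove φ)) ⟩
    withWindow p [] w (shiftStay φ) ℤ.+ withPrefix [] w (shiftStay (exchange φ))
      -- The leading stay and the erased move contribute `x y`, which is symmetric; the fixed
      -- exponents `i` and `b` are absorbed into the test.
      ≡⟨ window-prefix p [] w (shiftStay φ) (shiftStay (exchange φ)) ≤-refl (λ i b w′ eq′ →
           ∑-exchange n w′ (trans eq′ n≡) (λ s m i′ b′ → φ (suc s) (suc m) (i + i′) (b + b′))) ⟩
    withWindow p [] w (shiftStay (exchange φ)) ℤ.+ withPrefix [] w (shiftStay φ)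
      ≡⟨ cong (λ n → withWindow p [] w (shiftStay (exchange φ)) ℤ.+ n) (∑-exchange n w n≡ (shiftStay φ)) ⟩
    ∑ w (λ κ → value (exchange φ) 0 0 (stay ∷ κ)) ℤ.+ ∑ w (value (shiftMove (exchange φ)) 0 0) ∎
    where
    open ≡-Reasoning
    n≡ = suc-injective eq

-- Reversal of the word.

-- The pairs of inv grouped by their right element i; ρ lists the colours to the left of
-- κ, nearest first.
invFrom : (ℕ → ℕ) → List Colour → List Colour → ℕ
invFrom g ρ []      = 0
invFrom g ρ (c ∷ κ) = whenMove c (staysBy g ρ) + invFrom g (c ∷ ρ) κ

invBetween : (ℕ → ℕ) → List Colour → List Colour → ℕ
invBetween g []      κ = 0
invBetween g (c ∷ ρ) κ = whenStay c (movesBy g κ) + invBetween (g ∘ suc) ρ κ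

invBetween-∷ : ∀ g ρ c κ →
  invBetween g ρ (c ∷ κ) ≡ whenMove c (staysBy g ρ) + invBetween (g ∘ suc) ρ κ
invBetween-∷ g []          empty κ = refl
invBetween-∷ g []          stay  κ = refl
invBetween-∷ g []          move  κ = refl
invBetween-∷ g (empty ∷ ρ) c     κ = invBetween-∷ (g ∘ suc) ρ c κ
invBetween-∷ g (move  ∷ ρ) c     κ = invBetween-∷ (g ∘ suc) ρ c κ
invBetween-∷ g (stay  ∷ ρ) empty κ = cong (λ n → _ + n) (invBetween-∷ (g ∘ suc) ρ empty κ)
invBetween-∷ g (stay  ∷ ρ) stay  κ = cong (λ n → _ + n) (invBetween-∷ (g ∘ suc) ρ stay κ)
invBetween-∷ g (stay  ∷ ρ) move  κ = trans (cong (λ n → _ + n) (invBetween-∷ (g ∘ suc) ρ move κ))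
  (solve 4 (λ a b c d → (a :+ b) :+ (c :+ d) := (a :+ c) :+ (b :+ d)) refl
    (g 0) (movesBy (g ∘ suc) κ) (staysBy (g ∘ suc) ρ) _)
  where open ℕSolver.+-*-Solver

-- A pair whose move lies in `κ` has its stay either in `κ` or in `ρ`.
invFrom-inv : ∀ g ρ κ → invFrom g ρ κ ≡ inv g κ + invBetween g ρ κ
invFrom-inv g ρ [] = sym (none g ρ)
  where
  none : ∀ g ρ → invBetween g ρ [] ≡ 0
  none g []          = refl
  none g (empty ∷ ρ) = none (g ∘ suc) ρ
  none g (stay  ∷ ρ) = none (g ∘ suc) ρ
  none g (move  ∷ ρ) = none (g ∘ suc) ρ
invFrom-inv g ρ (c ∷ κ) = begin
  a + invFrom g (c ∷ ρ) κ   ≡⟨ cong (λ n → a + n) (invFrom-inv g (c ∷ ρ) κ) ⟩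
  a + (inv g κ + (b + d))   ≡⟨ solve 4 (λ a i b d → a :+ (i :+ (b :+ d)) := (b :+ i) :+ (a :+ d)) refl a (inv g κ) b d ⟩
  (b + inv g κ) + (a + d)   ≡⟨ cong (λ n → (b + inv g κ) + n) (invBetween-∷ g ρ c κ) ⟨
  (b + inv g κ) + invBetween g ρ (c ∷ κ) ∎
  where
  open ≡-Reasoning
  open ℕSolver.+-*-Solver
  a = whenMove c (staysBy g ρ)
  b = whenStay c (movesBy g κ)
  d = invBetween (g ∘ suc) ρ κ

movesBy-swap : ∀ g κ → movesBy g (map swap κ) ≡ staysBy g κ
movesBy-swap g []          = refl
movesBy-swap g (empty ∷ κ) = movesBy-swap (g ∘ suc) κ
movesBy-swap g (stay  ∷ κ) = cong (λ n → _ + n) (movesBy-swap (g ∘ suc) κ)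
movesBy-swap g (move  ∷ κ) = movesBy-swap (g ∘ suc) κ

-- Reversing and swapping colours both turn a pair around, so pairs are kept. As a move passes from
-- `κ` to `ρ`, its pairs with the stays of `ρ` become the pairs of a first letter that stays.
invFrom-ʳ++ : ∀ g ρ κ → invFrom g ρ κ + inv g (map swap ρ) ≡ inv g (map swap (κ ʳ++ ρ))
invFrom-ʳ++ g ρ []      = refl
invFrom-ʳ++ g ρ (c ∷ κ) = trans (step c) (invFrom-ʳ++ g (c ∷ ρ) κ)
  where
  open ℕSolver.+-*-Solver
  step : ∀ c → (whenMove c (staysBy g ρ) + invFrom g (c ∷ ρ) κ) + inv g (map swap ρ)
             ≡ invFrom g (c ∷ ρ) κ + inv g (map swap (c ∷ ρ))
  step empty = refl
  step stay  = refl
  step move  = trans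
    (solve 3 (λ a b c → (a :+ b) :+ c := b :+ (a :+ c)) refl (staysBy g ρ) _ _)
    (cong (λ n → invFrom g (move ∷ ρ) κ + (n + inv g (map swap ρ))) (sym (movesBy-swap g ρ)))

invFrom-[] : ∀ g κ → invFrom g [] κ ≡ inv g κ
invFrom-[] g κ = trans (invFrom-inv g [] κ) (+-identityʳ _)

invFrom-reverse : ∀ g κ → invFrom g [] (reverse κ) ≡ inv g (map swap κ)
invFrom-reverse g κ = begin
  invFrom g [] (reverse κ)               ≡⟨ +-identityʳ _ ⟨
  invFrom g [] (reverse κ) + 0           ≡⟨ invFrom-ʳ++ g [] (reverse κ) ⟩
  inv g (map swap (reverse (reverse κ))) ≡⟨ cong (inv g ∘ map swap) (reverse-involutive κ) ⟩
  inv g (map swap κ)                     ∎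
  where open ≡-Reasoning

moves-reverse : ∀ κ → moves (reverse κ) ≡ moves κ
moves-reverse κ = trans (moves-ʳ++ κ []) (+-identityʳ _)
  where
  moves-ʳ++ : ∀ κ ρ → moves (κ ʳ++ ρ) ≡ moves κ + moves ρ
  moves-ʳ++ []          ρ = refl
  moves-ʳ++ (empty ∷ κ) ρ = moves-ʳ++ κ (empty ∷ ρ)
  moves-ʳ++ (stay  ∷ κ) ρ = moves-ʳ++ κ (stay ∷ ρ)
  moves-ʳ++ (move  ∷ κ) ρ = trans (moves-ʳ++ κ (move ∷ ρ)) (+-suc (moves κ) (moves ρ))

stays-swap : ∀ κ → stays (map swap κ) ≡ moves κ
stays-swap []          = refl
stays-swap (empty ∷ κ) = stays-swap κ
stays-swap (stay  ∷ κ) = stays-swap κ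
stays-swap (move  ∷ κ) = cong suc (stays-swap κ)

-- Bits and heights read off from a colouring.

0b≢1b : 0b ≢ 1b
0b≢1b ()

-- The bit left at an already treated position, while position + r is still untreated.
bit : Colour → Bit
bit stay = 0b
bit _    = 1b

-- The default 1 is the infinite run of ones left of the word.
bitAt : List Colour → ℕ → Bit
bitAt []      _       = 1b
bitAt (c ∷ ρ) zero    = bit c
bitAt (c ∷ ρ) (suc j) = bitAt ρ j

ones : ℕ → List Colour → ℕ
ones n ρ = sum (applyUpTo (toℕ ∘ bitAt ρ) n)

ones+staysBy : ∀ n ρ → ones n ρ + staysBy (below n) ρ ≡ n
ones+staysBy zero ρ = staysBy-0 ρ
ones+staysBy (suc n) []          = cong suc (ones+staysBy n [])
ones+staysBy (suc n) (empty ∷ ρ) = cong suc (ones+staysBy n ρ)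
ones+staysBy (suc n) (stay  ∷ ρ) = trans (+-suc (ones n ρ) _) (cong suc (ones+staysBy n ρ))
ones+staysBy (suc n) (move  ∷ ρ) = cong suc (ones+staysBy n ρ)

staysBy-at : ∀ n ρ → staysBy (at n) ρ + toℕ (bitAt ρ n) ≡ 1
staysBy-at n       []          = refl
staysBy-at zero    (empty ∷ ρ) = cong (_+ 1) (staysBy-0 ρ)
staysBy-at zero    (stay  ∷ ρ) = cong (λ n → suc (n + 0)) (staysBy-0 ρ)
staysBy-at zero    (move  ∷ ρ) = cong (_+ 1) (staysBy-0 ρ)
staysBy-at (suc n) (empty ∷ ρ) = staysBy-at n ρ
staysBy-at (suc n) (stay  ∷ ρ) = staysBy-at n ρ
staysBy-at (suc n) (move  ∷ ρ) = staysBy-at n ρ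

heightFrom : ℕ → List Colour → List Colour → ℕ
heightFrom p ρ []      = 0
heightFrom p ρ (c ∷ κ) = whenMove c (ones p ρ) + heightFrom p (c ∷ ρ) κ

-- The window of each move has `p` bits: its ones make up the height, its zeros are the stays paired
-- with the move.
heightFrom+invFrom : ∀ p ρ κ → heightFrom p ρ κ + invFrom (below p) ρ κ ≡ moves κ * p
heightFrom+invFrom p ρ []          = refl
heightFrom+invFrom p ρ (empty ∷ κ) = heightFrom+invFrom p (empty ∷ ρ) κ
heightFrom+invFrom p ρ (stay  ∷ κ) = heightFrom+invFrom p (stay ∷ ρ) κ
heightFrom+invFrom p ρ (move  ∷ κ) = trans
  (solve 4 (λ a b c d → (a :+ b) :+ (c :+ d) := (a :+ c) :+ (b :+ d)) refl
    (ones p ρ) (heightFrom p (move ∷ ρ) κ) (staysBy (below p) ρ) _)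
  (cong₂ _+_ (ones+staysBy p ρ) (heightFrom+invFrom p (move ∷ ρ) κ))
  where open ℕSolver.+-*-Solver

heightFrom-∸ : ∀ p ρ κ → heightFrom p ρ κ ≡ moves κ * p ∸ invFrom (below p) ρ κ
heightFrom-∸ p ρ κ = trans (sym (m+n∸n≡m (heightFrom p ρ κ) (invFrom (below p) ρ κ)))
  (cong (_∸ invFrom (below p) ρ κ) (heightFrom+invFrom p ρ κ))

-- The specialisation `t = 0`, which discards colourings with a forbidden pair.
score : (ℕ → ℕ → ℤ) → ℕ → ℕ → ℕ → ℤ
score ψ zero    m h = ψ m h
score ψ (suc _) m h = 0ℤ

-- Coefficients as sums over subsequences of the letter positions.

total : ∀ {A : Set} → (A → ℤ) → List A → ℤ
total f []       = 0ℤ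
total f (x ∷ xs) = f x ℤ.+ total f xs

total-cong : ∀ {A : Set} {f g : A → ℤ} {xs} → All (λ x → f x ≡ g x) xs → total f xs ≡ total g xs
total-cong []         = refl
total-cong (eq ∷ eqs) = cong₂ ℤ._+_ eq (total-cong eqs)

total-0 : ∀ {A : Set} {f : A → ℤ} xs → (∀ x → f x ≡ 0ℤ) → total f xs ≡ 0ℤ
total-0 []       f≡0 = refl
total-0 (x ∷ xs) f≡0 = cong₂ ℤ._+_ (f≡0 x) (total-0 xs f≡0)

total-++ : ∀ {A : Set} (f : A → ℤ) xs ys → total f (xs ++ ys) ≡ total f xs ℤ.+ total f ys
total-++ f []       ys = sym (ℤ.+-identityˡ _)
total-++ f (x ∷ xs) ys = trans (cong (λ n → f x ℤ.+ n) (total-++ f xs ys)) (sym (ℤ.+-assoc (f x) _ _))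

total-map : ∀ {A B : Set} (f : B → ℤ) (h : A → B) xs → total f (map h xs) ≡ total (f ∘ h) xs
total-map f h []       = refl
total-map f h (x ∷ xs) = cong (λ n → f (h x) ℤ.+ n) (total-map f h xs)

total-subsequences-∷ : ∀ (f : List ℤ → ℤ) x xs → total f (subsequences (x ∷ xs)) ≡
  total f (subsequences xs) ℤ.+ total (f ∘ (x ∷_)) (subsequences xs)
total-subsequences-∷ f x xs = trans (total-++ f (subsequences xs) _)
  (cong (λ n → total f (subsequences xs) ℤ.+ n) (total-map f (x ∷_) (subsequences xs)))

subsequences-AllPairs : ∀ {R : ℤ → ℤ → Set} {xs} → AllPairs R xs → All (AllPairs R) (subsequences xs)
subsequences-AllPairs []         = [] ∷ []
subsequences-AllPairs (rx ∷ rxs) = All.++⁺ ih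
  (All.map⁺ (All.zipWith (λ (h , t) → h ∷ t) (subsequences-All rx , ih)))
  where ih = subsequences-AllPairs rxs

indicator : ℕ → ℕ → ℕ → ℕ → ℤ
indicator a b m h = if does ((m ≟ a) ×-dec (h ≟ b)) then 1ℤ else 0ℤ

coeff-filter : ∀ {A : Set} {P : A → Set} (P? : Decidable P) (m h : A → ℕ) a b xs →
  coeff (map (λ x → 1ℤ ·X^ m x Y^ h x) (filter P? xs)) a b ≡
  total (λ x → if does (P? x) then indicator a b (m x) (h x) else 0ℤ) xs
coeff-filter P? m h a b [] = refl
coeff-filter P? m h a b (x ∷ xs) with does (P? x)
... | true  = cong (λ n → indicator a b (m x) (h x) ℤ.+ n) (coeff-filter P? m h a b xs)
... | false = trans (coeff-filter P? m h a b xs) (sym (ℤ.+-identityˡ _))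

addRibbon-at : ∀ r s i → addRibbon r s i i ≡ 1b
addRibbon-at r s i rewrite dec-true (i ℤ.≟ i) refl = refl

addRibbon-elsewhere : ∀ r s {i j} → j ≢ i → j ≢ i ℤ.- + r → addRibbon r s i j ≡ s j
addRibbon-elsewhere r s {i} {j} j≢i j≢i-r
  rewrite dec-false (j ℤ.≟ i) j≢i | dec-false (j ℤ.≟ (i ℤ.- + r)) j≢i-r = refl

suc-- : ∀ m n → + suc m ℤ.- + suc (suc n) ≡ + m ℤ.- + suc n
suc-- m n = trans (ℤ.[1+m]⊖[1+n]≡m⊖n m (suc n)) (sym (ℤ.m-n≡m⊖n m (suc n)))

-‿injective : ∀ i {m n} → i ℤ.- + m ≡ i ℤ.- + n → m ≡ n
-‿injective i eq = ℤ.+-injective (ℤ.neg-injective (∙-cancelˡ ℤ.+-0-abelianGroup i _ _ eq))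

module _ (p : ℕ) where

  private r = suc p

  weight : BitSeq → (ℕ → ℕ → ℤ) → List ℤ → ℤ
  weight s ψ is = if does (canAddAll? r s is) then ψ (length is) (totalHeight r s is) else 0ℤ

  weight-blocked : ∀ s ψ {i} → ¬ (s (i ℤ.- + r) ≡ 1b × s i ≡ 0b) → ∀ is → weight s ψ (i ∷ is) ≡ 0ℤ
  weight-blocked s ψ {i} ¬pq is
    rewrite dec-false (canAddAll? r s (i ∷ is)) (λ { (add x y _) → ¬pq (x , y) }) = refl

  weight-∷ : ∀ s ψ {i} → s (i ℤ.- + r) ≡ 1b → s i ≡ 0b → ∀ is →
    weight s ψ (i ∷ is) ≡ weight (addRibbon r s i) (λ m h → ψ (suc m) (height r s i + h)) is
  weight-∷ s ψ {i} x y is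
    rewrite does-⇔ (mk⇔ (λ { (add _ _ c) → c }) (add x y))
              (canAddAll? r s (i ∷ is)) (canAddAll? r (addRibbon r s i) is) = refl

  height-ones : ∀ s i ρ → (∀ j → j < r → s (i ℤ.- + suc j) ≡ bitAt ρ j) → height r s i ≡ ones p ρ
  height-ones s i ρ window = trans
    (cong sum (map-applyUpTo (λ k → k) (λ k → toℕ (s (i ℤ.- + suc k))) p))
    (sum-cong p (λ k k<p → cong toℕ (window k (m<n⇒m<1+n k<p))))
    where
    sum-cong : ∀ n {f g : ℕ → ℕ} → (∀ k → k < n → f k ≡ g k) → sum (applyUpTo f n) ≡ sum (applyUpTo g n)
    sum-cong zero    f≗g = refl
    sum-cong (suc n) f≗g = cong₂ _+_ (f≗g 0 (s≤s z≤n)) (sum-cong n (λ k k<n → f≗g (suc k) (s≤s k<n)))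

  -- Taking or skipping a position is colouring it. The invariant: from `f 0` on, `s` is still the
  -- original word, and the `r` bits before are given by the colours `ρ`. `ψ` absorbs the ribbons
  -- already added.
  total-weight : ∀ ρ w s (f : ℕ → ℕ) ψ → (∀ j → f (suc j) ≡ suc (f j)) →
    (∀ j → s (+ f j) ≡ extend w (+ j)) →
    (∀ j → j < r → s (+ f 0 ℤ.- + suc j) ≡ bitAt ρ j) →
    total (weight s ψ) (subsequences (map +_ (applyUpTo f (length w)))) ≡
    ∑ w (λ κ → score ψ (invFrom (at p) ρ κ) (moves κ) (heightFrom p ρ κ))
  total-weight ρ [] s f ψ f-suc right left = ℤ.+-identityʳ _
  total-weight ρ (b ∷ w) s f ψ f-suc right left = trans
    (total-subsequences-∷ (weight s ψ) i is) (go b (right 0))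
    where
    open ≡-Reasoning
    i = + f 0
    is = map +_ (applyUpTo (f ∘ suc) (length w))
    s′ = addRibbon r s i

    -- Only `p` of the `r` bits remain visible from the next position. The one dropped is at
    -- `i - r`, exactly where a ribbon writes its 0.
    left-∷ : ∀ t c → t i ≡ bit c → (∀ j → j < p → t (i ℤ.- + suc j) ≡ bitAt ρ j) →
      ∀ j → j < r → t (+ f 1 ℤ.- + suc j) ≡ bitAt (c ∷ ρ) j
    left-∷ t c t-i t-left zero    _ = trans (cong (λ n → t (+ n ℤ.- + 1)) (f-suc 0)) t-i
    left-∷ t c t-i t-left (suc j) (s≤s j<p) = trans
      (cong t (trans (cong (λ n → + n ℤ.- + suc (suc j)) (f-suc 0)) (suc-- (f 0) j)))
      (t-left j j<p)

    unmoved : ∀ c → s i ≡ bit c → total (weight s ψ) (subsequences is) ≡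
      ∑ w (λ κ → score ψ (invFrom (at p) (c ∷ ρ) κ) (moves κ) (heightFrom p (c ∷ ρ) κ))
    unmoved c s-i = total-weight (c ∷ ρ) w s (f ∘ suc) ψ (f-suc ∘ suc) (right ∘ suc)
      (left-∷ s c s-i (λ j j<p → left j (m<n⇒m<1+n j<p)))

    f-< : ∀ j → f 0 < f (suc j)
    f-< zero    = ≤-reflexive (sym (f-suc 0))
    f-< (suc j) = ≤-trans (f-< j) (≤-trans (n≤1+n _) (≤-reflexive (sym (f-suc (suc j)))))

    moved : s i ≡ 0b → total (weight s ψ ∘ (i ∷_)) (subsequences is) ≡
      ∑ w (λ κ → score ψ (staysBy (at p) ρ + invFrom (at p) (move ∷ ρ) κ)
                         (suc (moves κ)) (ones p ρ + heightFrom p (move ∷ ρ) κ))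
    -- The bit at `i - r` is 0 precisely when a stay sits there. Then the ribbon is blocked, and the
    -- forbidden pair makes every score 0.
    moved s-i with bitAt ρ p in eq | staysBy (at p) ρ | staysBy-at p ρ
    ... | zero | suc n | _ = trans
      (total-0 (subsequences is) (weight-blocked s ψ λ (s≡1 , _) →
        0b≢1b (trans (trans (sym eq) (sym (left p ≤-refl))) s≡1)))
      (sym (∑-0 w))
    ... | suc zero | suc n | n+1≡0 = ⊥-elim (m+1+n≢0 n (suc-injective n+1≡0))
    ... | suc zero | zero | _ = begin
      total (weight s ψ ∘ (i ∷_)) (subsequences is)
        ≡⟨ total-cong (All.universal (weight-∷ s ψ (trans (left p ≤-refl) eq) s-i) (subsequences is)) ⟩
      total (weight s′ (λ m h → ψ (suc m) (height r s i + h))) (subsequences is)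
        ≡⟨ total-weight (move ∷ ρ) w s′ (f ∘ suc) _ (f-suc ∘ suc)
             (λ j → trans (addRibbon-beyond r s (+<+ (f-< j))) (right (suc j)))
             (left-∷ s′ move (addRibbon-at r s i) λ j j<p → trans
               (addRibbon-elsewhere r s
                 (λ eq′ → 1+n≢0 (-‿injective i (trans eq′ (sym (ℤ.+-identityʳ i)))))
                 (λ eq′ → <⇒≢ j<p (suc-injective (-‿injective i eq′))))
               (left j (m<n⇒m<1+n j<p))) ⟩
      ∑ w (λ κ → score (λ m h → ψ (suc m) (height r s i + h))
                       (invFrom (at p) (move ∷ ρ) κ) (moves κ) (heightFrom p (move ∷ ρ) κ))
        ≡⟨ ∑-cong w (λ κ → score-shift (invFrom (at p) (move ∷ ρ) κ)) ⟩
      ∑ w (λ κ → score ψ (invFrom (at p) (move ∷ ρ) κ)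
                         (suc (moves κ)) (ones p ρ + heightFrom p (move ∷ ρ) κ)) ∎
      where
      score-shift : ∀ b {m h} → score (λ m h → ψ (suc m) (height r s i + h)) b m h
                              ≡ score ψ b (suc m) (ones p ρ + h)
      score-shift zero    {m} {h} = cong (λ n → ψ (suc m) (n + h)) (height-ones s i ρ left)
      score-shift (suc _) = refl

    go : ∀ b → s i ≡ b →
      total (weight s ψ) (subsequences is) ℤ.+ total (weight s ψ ∘ (i ∷_)) (subsequences is) ≡
      ∑ (b ∷ w) (λ κ → score ψ (invFrom (at p) ρ κ) (moves κ) (heightFrom p ρ κ))
    go zero       s-i = cong₂ ℤ._+_ (unmoved stay s-i) (moved s-i)
    go (suc zero) s-i = trans (cong₂ ℤ._+_ (unmoved empty s-i)
      (total-0 (subsequences is) (weight-blocked s ψ λ (_ , s≡0) → 0b≢1b (trans (sym s≡0) s-i))))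
      (ℤ.+-identityʳ _)

  -- The height is recovered from the exponents by `heightFrom-∸`; the truncated subtraction is
  -- exact on actual colourings.
  coeffTest : ℕ → ℕ → Test
  coeffTest a b s m i k = score (indicator a b) k m (m * p ∸ i)

  coeff-R₁₁ : ∀ w a b → coeff (R₁₁ w r) a b ≡
    ∑ w (λ κ → coeffTest a b 0 (moves κ) (invFrom (below p) [] κ) (invFrom (at p) [] κ))
  coeff-R₁₁ w a b = begin
    coeff (R₁₁ w r) a b
      ≡⟨ coeff-filter (isPlacement? r (extend w)) length (totalHeight r (extend w)) a b
           (subsequences (letterPositions w)) ⟩
    total (λ is → if does (isPlacement? r (extend w) is) then _ else 0ℤ) (subsequences (letterPositions w))
      -- Subsequences of the increasing letter positions are increasing, so only `CanAddAll` remains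
      -- to be tested.
      ≡⟨ total-cong (All.map drop-linked (subsequences-AllPairs (letterPositions-< w))) ⟩
    total (weight (extend w) (indicator a b)) (subsequences (letterPositions w))
      ≡⟨ total-weight [] w (extend w) (λ k → k) (indicator a b) (λ _ → refl) (λ _ → refl) (λ _ _ → extend-left w) ⟩
    ∑ w (λ κ → score (indicator a b) (invFrom (at p) [] κ) (moves κ) (heightFrom p [] κ))
      ≡⟨ ∑-cong w (λ κ → cong (score (indicator a b) (invFrom (at p) [] κ) (moves κ)) (heightFrom-∸ p [] κ)) ⟩
    ∑ w (λ κ → coeffTest a b 0 (moves κ) (invFrom (below p) [] κ) (invFrom (at p) [] κ)) ∎
    where
    open ≡-Reasoning
    extend-left : ∀ w {j} → extend w (+ 0 ℤ.- + suc j) ≡ 1b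
    extend-left []      = refl
    extend-left (_ ∷ w) = refl
    drop-linked : ∀ {is} → AllPairs ℤ._<_ is →
      (if does (isPlacement? r (extend w) is) then indicator a b (length is) (totalHeight r (extend w) is) else 0ℤ)
      ≡ weight (extend w) (indicator a b) is
    drop-linked {is} is< rewrite does-⇔ (mk⇔ proj₂ (AllPairs⇒Linked is< ,_))
      (isPlacement? r (extend w) is) (canAddAll? r (extend w) is) = refl

claim1p1p1 : (r : ℕ) .{{_ : NonZero r}} (w : Word) → R₁₁ w r ≈ R₁₁ (reverse w) r
claim1p1p1 (suc p) w a b = begin
  coeff (R₁₁ w (suc p)) a b
    ≡⟨ coeff-R₁₁ p w a b ⟩
  ∑ w (λ κ → φ 0 (moves κ) (invFrom (below p) [] κ) (invFrom (at p) [] κ))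
    ≡⟨ ∑-cong w (λ κ → cong₂ (φ 0 (moves κ)) (invFrom-[] (below p) κ) (invFrom-[] (at p) κ)) ⟩
  ∑ w (value p φ 0 0)
    ≡⟨ ∑-exchange p (length w) w refl φ ⟩
  ∑ w (value p (exchange φ) 0 0)
    -- The exchanged test treats the stays as ribbons; swapping the colours and reversing the word
    -- makes them moves again.
    ≡⟨ ∑-swap w _ ⟨
  ∑ w (λ κ → φ 0 (stays (map swap κ)) (inv (below p) (map swap κ)) (inv (at p) (map swap κ)))
    ≡⟨ ∑-cong w (λ κ → reversed κ) ⟨
  ∑ w (λ κ → φ 0 (moves (reverse κ)) (invFrom (below p) [] (reverse κ)) (invFrom (at p) [] (reverse κ)))
    ≡⟨ ∑-reverse w _ ⟨
  ∑ (reverse w) (λ κ → φ 0 (moves κ) (invFrom (below p) [] κ) (invFrom (at p) [] κ))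
    ≡⟨ coeff-R₁₁ p (reverse w) a b ⟨
  coeff (R₁₁ (reverse w) (suc p)) a b ∎
  where
  open ≡-Reasoning
  φ = coeffTest p a b
  reversed : ∀ κ →
    φ 0 (moves (reverse κ)) (invFrom (below p) [] (reverse κ)) (invFrom (at p) [] (reverse κ)) ≡
    φ 0 (stays (map swap κ)) (inv (below p) (map swap κ)) (inv (at p) (map swap κ))
  reversed κ
    rewrite moves-reverse κ | stays-swap κ | invFrom-reverse (below p) κ | invFrom-reverse (at p) κ = refl
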